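{- Let $v\in(0,1)$ and put $a=1+\sqrt{\frac{2v^2}{v(1+v)}}$. Consider the agent that starts at the origin $0$ of the real line at time $0$ and, for rounds $i=0,1,2,\dots$ until the target is found, performs in round $i$ the following moves: (1) it moves from $0$ to $(-1)^{i+1}a^{i-2}$ at speed $1$; (2) it moves from there to $(-1)^{i+1}a^{i}$ at speed $v$; (3) it moves back to $0$ at speed $1$. In the model where the target can be detected only when the agent moves at speed $v$ (i.e. $p=0$), the competitive ratio of this algorithm is $$3+2\sqrt{2+\frac{2}{v}}+\frac{2}{v}.$$
   Context: Search model (the case $p=0$): a stationary target is located at an unknown point $x$ of the real line with $|x|\ge 1$. The agent can move at speed $1$ or at the slower speed $v$. When the agent passes through (or reaches an endpoint of its slow move at) the target's location while moving at speed $v$, it detects the target with certainty; when moving at speed $1$ it never detects the target. The search ends at the first detection; let $\tau(x)$ be the time of that detection. An omniscient agent needs time $|x|$ to reach the target (at speed $1$). The competitive ratio of the algorithm is $$\sup_{|x|\ge 1}\frac{\tau(x)}{|x|}.$$ -}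

module Defs where

open import Algebra.Bundles using (CommutativeRing)
import Algebra.Properties.Group as GroupProperties
import Algebra.Properties.Semiring.Exp as Exp
import Algebra.Solver.Ring.NaturalCoefficients.Default as Solver
open import Data.Empty using (⊥-elim)
open import Data.Integer.Base as ℤ using (ℤ; +_; -[1+_])
open import Data.List.Base using (List; []; _∷_; foldl)
open import Data.Nat.Base using (ℕ; zero; suc)
open import Data.Product.Base using (∃; ∃₂; _×_; _,_; proj₁; proj₂)
open import Data.Sum.Base using (inj₁; inj₂)
open import Level using (0ℓ)
open import Relation.Binary.Bundles using (StrictTotalOrder)
import Relation.Binary.Construct.StrictToNonStrict as NonStrict
open import Relation.Binary.Core using (Rel)
open import Relation.Binary.Definitions using (tri<; tri≈; tri>)
open import Relation.Binary.PropositionalEquality.Core using (_≡_)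
open import Relation.Binary.Structures using (IsStrictTotalOrder)
open import Relation.Nullary.Negation.Core using (¬_)

record OrderedField : Set₁ where
  infix  4 _<_
  infixl 7 _/_
  infix  9 _⁻¹

  field
    commutativeRing : CommutativeRing 0ℓ 0ℓ

  open CommutativeRing commutativeRing public

  field
    _<_                : Rel Carrier 0ℓ
    isStrictTotalOrder : IsStrictTotalOrder _≈_ _<_
    0<1                : 0# < 1#
    +-monoˡ-<          : ∀ {x y} z → x < y → x + z < y + z
    *-pos              : ∀ {x y} → 0# < x → 0# < y → 0# < x * y
    -- Total, with an unspecified value at 0.
    _⁻¹                : Carrier → Carrier
    ⁻¹-inverseʳ        : ∀ {x} → ¬ x ≈ 0# → x * x ⁻¹ ≈ 1#

  strictTotalOrder : StrictTotalOrder 0ℓ 0ℓ 0ℓ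
  strictTotalOrder = record { isStrictTotalOrder = isStrictTotalOrder }

  open IsStrictTotalOrder isStrictTotalOrder public
    using (compare; <-respˡ-≈; <-respʳ-≈; irrefl; asym)
    renaming (trans to <-trans)

  open NonStrict _≈_ _<_ public using (_≤_)

  _/_ : Carrier → Carrier → Carrier
  x / y = x * y ⁻¹

  IsUpperBound : (Carrier → Set) → Carrier → Set
  IsUpperBound P b = ∀ x → P x → x ≤ b

  -- `approached` says positively that no b < s is an upper bound; it implies
  -- that s is the least upper bound, and is equivalent to it classically.
  record IsSup (P : Carrier → Set) (s : Carrier) : Set where
    field
      upperBound : IsUpperBound P s
      approached : ∀ b → b < s → ∃ λ x → P x × b < x

-- The real numbers of classical mathematics, given axiomatically: classically,
-- such a structure exists and is unique up to isomorphism.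
record CompleteOrderedField : Set₁ where
  field
    orderedField : OrderedField

  open OrderedField orderedField public

  field
    complete : ∀ (P : Carrier → Set) → ∃ P → ∃ (IsUpperBound P) → ∃ (IsSup P)

module RealFunctions (ℝ : CompleteOrderedField) where
  open CompleteOrderedField ℝ

  open Exp semiring public using (_^_)

  infixr 8 _^ᶻ_

  2# 3# : Carrier
  2# = 1# + 1#
  3# = 2# + 1#

  _^ᶻ_ : Carrier → ℤ → Carrier
  x ^ᶻ (+ n)    = x ^ n
  x ^ᶻ -[1+ n ] = (x ⁻¹) ^ suc n

  ∣_∣ : Carrier → Carrier
  ∣ x ∣ with compare x 0#
  ... | tri< _ _ _ = - x
  ... | tri≈ _ _ _ = x
  ... | tri> _ _ _ = x

  IsSqrt : Carrier → Carrier → Set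
  IsSqrt r x = 0# ≤ r × r * r ≈ x

  private
    open Solver commutativeSemiring using (solve; _:=_; _:+_; _:*_; con)
    open GroupProperties +-group using () renaming (∙-cancelʳ to +-cancelʳ)
    open import Relation.Binary.Reasoning.StrictPartialOrder
      (StrictTotalOrder.strictPartialOrder strictTotalOrder)

    ≤-<-absurd : ∀ {x y} → x ≤ y → ¬ y < x
    ≤-<-absurd (inj₁ p) q = asym p q
    ≤-<-absurd (inj₂ p) q = irrefl (sym p) q

    x<x+y : ∀ x {y} → 0# < y → x < x + y
    x<x+y x {y} p = begin-strict
      x       ≈⟨ +-identityˡ x ⟨
      0# + x  <⟨ +-monoˡ-< x p ⟩
      y + x   ≈⟨ +-comm y x ⟩
      x + y   ∎

    +-pos : ∀ {x y} → 0# ≤ x → 0# < y → 0# < x + y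
    +-pos (inj₁ p) q = <-trans p (x<x+y _ q)
    +-pos (inj₂ p) q = <-respʳ-≈ (trans (sym (+-identityˡ _)) (+-congʳ p)) q

    difference : ∀ {x y} → x < y → ∃ λ d → 0# < d × y ≈ x + d
    difference {x} {y} p =
      y - x , <-respˡ-≈ (-‿inverseʳ x) (+-monoˡ-< (- x) p) , (begin-equality
      y              ≈⟨ +-identityʳ y ⟨
      y + 0#         ≈⟨ +-congˡ (-‿inverseˡ x) ⟨
      y + (- x + x)  ≈⟨ +-assoc y (- x) x ⟨
      (y - x) + x    ≈⟨ +-comm _ x ⟩
      x + (y - x)    ∎)

    *-monoˡ-< : ∀ {x y} z → 0# < z → x < y → x * z < y * z
    *-monoˡ-< {x} {y} z 0<z x<y with d , 0<d , y≈x+d ← difference x<y = begin-strict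
      x * z          <⟨ x<x+y (x * z) (*-pos 0<d 0<z) ⟩
      x * z + d * z  ≈⟨ distribʳ z x d ⟨
      (x + d) * z    ≈⟨ *-congʳ y≈x+d ⟨
      y * z          ∎

    *-cancel-< : ∀ {x y} z → 0# < z → x * z < y * z → x < y
    *-cancel-< {x} {y} z 0<z p with compare x y
    ... | tri< q _ _ = q
    ... | tri≈ _ q _ = ⊥-elim (irrefl (*-congʳ q) p)
    ... | tri> _ _ q = ⊥-elim (asym (*-monoˡ-< z 0<z q) p)

    square-mono-< : ∀ {x y} → 0# ≤ x → x < y → x * x < y * y
    square-mono-< {x} {y} 0≤x x<y with d , 0<d , y≈x+d ← difference x<y = begin-strict
      x * x                          <⟨ x<x+y (x * x) (*-pos (+-pos 0≤x (+-pos 0≤x 0<d)) 0<d) ⟩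
      x * x + (x + (x + d)) * d
        ≈⟨ solve 2 (λ x d → x :* x :+ (x :+ (x :+ d)) :* d := (x :+ d) :* (x :+ d)) refl x d ⟩
      (x + d) * (x + d)              ≈⟨ *-cong y≈x+d y≈x+d ⟨
      y * y                          ∎

    quotient : ∀ {d c} → 0# < d → 0# < c → ∃ λ e → 0# < e × e * c ≈ d
    quotient {d} {c} 0<d 0<c = d / c , *-cancel-< c 0<c 0<ec , ec≈d
      where
      ec≈d : d / c * c ≈ d
      ec≈d = begin-equality
        d * c ⁻¹ * c    ≈⟨ *-assoc d (c ⁻¹) c ⟩
        d * (c ⁻¹ * c)  ≈⟨ *-congˡ (*-comm (c ⁻¹) c) ⟩
        d * (c * c ⁻¹)  ≈⟨ *-congˡ (⁻¹-inverseʳ (λ c≈0 → irrefl (sym c≈0) 0<c)) ⟩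
        d * 1#          ≈⟨ *-identityʳ d ⟩
        d               ∎
      0<ec : 0# * c < d / c * c
      0<ec = <-respˡ-≈ (sym (zeroˡ c)) (<-respʳ-≈ (sym ec≈d) 0<d)

  sqrt-exists : ∀ x → 0# < x → ∃ λ r → IsSqrt r x
  sqrt-exists x 0<x = r , 0≤r , r²≈x
    where
    S : Carrier → Set
    S y = 0# ≤ y × y * y ≤ x

    0∈S : S 0#
    0∈S = inj₂ refl , inj₁ (<-respˡ-≈ (sym (zeroˡ 0#)) 0<x)

    bounded : IsUpperBound S (x + 1#)
    bounded y (_ , y²≤x) with compare y (x + 1#)
    ... | tri< p _ _ = inj₁ p
    ... | tri≈ _ p _ = inj₂ p
    ... | tri> _ _ p = ⊥-elim (≤-<-absurd y²≤x (begin-strict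
      x                         <⟨ x<x+y x (+-pos (inj₁ (*-pos 0<x 0<x)) (+-pos (inj₁ 0<x) 0<1)) ⟩
      x + (x * x + (x + 1#))
        ≈⟨ solve 1 (λ x → x :+ (x :* x :+ (x :+ con 1)) := (x :+ con 1) :* (x :+ con 1)) refl x ⟩
      (x + 1#) * (x + 1#)       <⟨ square-mono-< (inj₁ (+-pos (inj₁ 0<x) 0<1)) p ⟩
      y * y                     ∎))

    sup : ∃ (IsSup S)
    sup = complete S (0# , 0∈S) (x + 1# , bounded)

    r : Carrier
    r = proj₁ sup

    open IsSup (proj₂ sup)

    0≤r : 0# ≤ r
    0≤r = upperBound 0# 0∈S

    r²≮x : ¬ r * r < x
    r²≮x r²<x = ≤-<-absurd (upperBound (r + e) (inj₁ (+-pos 0≤r 0<e) , inj₁ below)) (x<x+y r 0<e)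
      where
      d = proj₁ (difference r²<x)
      0<d = proj₁ (proj₂ (difference r²<x))
      x≈r²+d = proj₂ (proj₂ (difference r²<x))
      0<2r+1 : 0# < r + (r + 1#)
      0<2r+1 = +-pos 0≤r (+-pos 0≤r 0<1)
      c = d + (r + (r + 1#))
      0<c : 0# < c
      0<c = +-pos (inj₁ 0<d) 0<2r+1
      e = proj₁ (quotient 0<d 0<c)
      0<e = proj₁ (proj₂ (quotient 0<d 0<c))
      ec≈d = proj₂ (proj₂ (quotient 0<d 0<c))
      e<1 : e < 1#
      e<1 = *-cancel-< c 0<c (begin-strict
        e * c   ≈⟨ ec≈d ⟩
        d       <⟨ x<x+y d 0<2r+1 ⟩
        c       ≈⟨ *-identityˡ c ⟨
        1# * c  ∎)
      e+2r<c : e + (r + r) < c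
      e+2r<c = begin-strict
        e + (r + r)         <⟨ +-monoˡ-< (r + r) e<1 ⟩
        1# + (r + r)        <⟨ x<x+y _ 0<d ⟩
        1# + (r + r) + d
          ≈⟨ solve 2 (λ r d → con 1 :+ (r :+ r) :+ d := d :+ (r :+ (r :+ con 1))) refl r d ⟩
        c                   ∎
      below : (r + e) * (r + e) < x
      below = begin-strict
        (r + e) * (r + e)
          ≈⟨ solve 2 (λ r e → (r :+ e) :* (r :+ e) := (e :+ (r :+ r)) :* e :+ r :* r) refl r e ⟩
        (e + (r + r)) * e + r * r  <⟨ +-monoˡ-< (r * r) (*-monoˡ-< e 0<e e+2r<c) ⟩
        c * e + r * r              ≈⟨ +-congʳ (trans (*-comm c e) ec≈d) ⟩
        d + r * r                  ≈⟨ +-comm d _ ⟩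
        r * r + d                  ≈⟨ x≈r²+d ⟨
        x                          ∎

    r²≯x : ¬ x < r * r
    r²≯x x<r² = ≤-<-absurd (proj₂ y∈S) (begin-strict
        x          <⟨ x<x+y x (*-pos 0<e 0<e) ⟩
        x + e * e  ≈⟨ b²≈x+e² ⟨
        b * b      <⟨ square-mono-< (inj₁ 0<b) b<y ⟩
        y * y      ∎)
      where
      d = proj₁ (difference x<r²)
      0<d = proj₁ (proj₂ (difference x<r²))
      r²≈x+d = proj₂ (proj₂ (difference x<r²))
      0<r : 0# < r
      0<r with 0≤r
      ... | inj₁ p = p
      ... | inj₂ p = ⊥-elim (irrefl (trans (sym (zeroˡ 0#)) (*-cong p p)) (<-trans 0<x x<r²))
      0<2r : 0# < r + r
      0<2r = +-pos 0≤r 0<r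
      e = proj₁ (quotient 0<d 0<2r)
      0<e = proj₁ (proj₂ (quotient 0<d 0<2r))
      e2r≈d = proj₂ (proj₂ (quotient 0<d 0<2r))
      e<r : e < r
      e<r = *-cancel-< (r + r) 0<2r (begin-strict
        e * (r + r)               ≈⟨ e2r≈d ⟩
        d                         <⟨ x<x+y d (+-pos (inj₁ 0<x) 0<x+d) ⟩
        d + (x + (x + d))
          ≈⟨ solve 2 (λ x d → d :+ (x :+ (x :+ d)) := (x :+ d) :+ (x :+ d)) refl x d ⟩
        (x + d) + (x + d)         ≈⟨ +-cong r²≈x+d r²≈x+d ⟨
        r * r + r * r             ≈⟨ distribˡ r r r ⟨
        r * (r + r)               ∎)
        where
        0<x+d : 0# < x + d
        0<x+d = +-pos (inj₁ 0<x) 0<d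
      b = proj₁ (difference e<r)
      0<b = proj₁ (proj₂ (difference e<r))
      r≈e+b = proj₂ (proj₂ (difference e<r))
      b²≈x+e² : b * b ≈ x + e * e
      b²≈x+e² = +-cancelʳ (e * e + (e * b + e * b)) _ _ (begin-equality
        b * b + (e * e + (e * b + e * b))
          ≈⟨ solve 2 (λ e b → b :* b :+ (e :* e :+ (e :* b :+ e :* b)) := (e :+ b) :* (e :+ b)) refl e b ⟩
        (e + b) * (e + b)                ≈⟨ *-cong r≈e+b r≈e+b ⟨
        r * r                            ≈⟨ r²≈x+d ⟩
        x + d                            ≈⟨ +-congˡ e2r≈d ⟨
        x + e * (r + r)                  ≈⟨ +-congˡ (*-congˡ (+-cong r≈e+b r≈e+b)) ⟩
        x + e * ((e + b) + (e + b))
          ≈⟨ solve 3 (λ x e b → x :+ e :* ((e :+ b) :+ (e :+ b))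
                             := x :+ e :* e :+ (e :* e :+ (e :* b :+ e :* b))) refl x e b ⟩
        x + e * e + (e * e + (e * b + e * b))  ∎)
      b<r : b < r
      b<r = <-respʳ-≈ (trans (+-comm b e) (sym r≈e+b)) (x<x+y b 0<e)
      y = proj₁ (approached b b<r)
      y∈S = proj₁ (proj₂ (approached b b<r))
      b<y = proj₂ (proj₂ (approached b b<r))

    r²≈x : r * r ≈ x
    r²≈x with compare (r * r) x
    ... | tri< p _ _ = ⊥-elim (r²≮x p)
    ... | tri≈ _ p _ = p
    ... | tri> _ _ p = ⊥-elim (r²≯x p)

  -- Total, with value 0 on negative numbers.
  √_ : Carrier → Carrier
  √ x with compare 0# x
  ... | tri< 0<x _ _ = proj₁ (sqrt-exists x 0<x)
  ... | tri≈ _ _ _   = 0#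
  ... | tri> _ _ _   = 0#

  √-isSqrt : ∀ {x} → 0# ≤ x → IsSqrt (√ x) x
  √-isSqrt {x} 0≤x with compare 0# x
  ... | tri< 0<x _ _ = proj₂ (sqrt-exists x 0<x)
  ... | tri≈ _ 0≈x _ = inj₂ refl , trans (zeroˡ 0#) 0≈x
  ... | tri> _ _ x<0 = ⊥-elim (≤-<-absurd 0≤x x<0)

-- Searching the line for a stationary target when detection is possible only
-- while moving at the slow speed v.
module Search (ℝ : CompleteOrderedField) (v : CompleteOrderedField.Carrier ℝ) where
  open CompleteOrderedField ℝ
  open RealFunctions ℝ

  data Pace : Set where
    full slow : Pace

  speed : Pace → Carrier
  speed full = 1#
  speed slow = v

  record Move : Set where
    constructor to_at_
    field
      destination : Carrier
      pace        : Pace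

  open Move

  record State : Set where
    constructor ⟨_,_⟩
    field
      position time : Carrier

  open State

  duration : State → Move → Carrier
  duration s m = ∣ destination m - position s ∣ / speed (pace m)

  perform : State → Move → State
  perform s m = ⟨ destination m , time s + duration s m ⟩

  -- The moves of each round; a round begins where the previous one ended.
  Strategy : Set
  Strategy = ℕ → List Move

  roundStart : Strategy → ℕ → State
  roundStart σ zero    = ⟨ 0# , 0# ⟩
  roundStart σ (suc i) = foldl perform (roundStart σ i) (σ i)

  -- During move m begun in state s the agent is at x at time t; since the speed
  -- is constant, position and time are affine in the completed fraction θ.
  PassesAt : Carrier → Carrier → State → Move → Set
  PassesAt x t s m = ∃ λ θ → 0# ≤ θ × θ ≤ 1#
    × x ≈ position s + θ * (destination m - position s)
    × t ≈ time s + θ * duration s m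

  -- A slow pass through x at time t during the given moves, begun in state s.
  data SlowPass (x t : Carrier) (s : State) : List Move → Set where
    here  : ∀ {m ms} → pace m ≡ slow → PassesAt x t s m → SlowPass x t s (m ∷ ms)
    there : ∀ {m ms} → SlowPass x t (perform s m) ms → SlowPass x t s (m ∷ ms)

  SlowPassAt : Strategy → Carrier → Carrier → Set
  SlowPassAt σ x t = ∃ λ i → SlowPass x t (roundStart σ i) (σ i)

  -- t is τ(x).
  IsDetectionTime : Strategy → Carrier → Carrier → Set
  IsDetectionTime σ x t = SlowPassAt σ x t × (∀ t′ → SlowPassAt σ x t′ → t ≤ t′)

  Ratio : Strategy → Carrier → Set
  Ratio σ q = ∃₂ λ x t → 1# ≤ ∣ x ∣ × IsDetectionTime σ x t × q ≈ t / ∣ x ∣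

  -- τ is everywhere defined (otherwise the ratio would be infinite), and the
  -- supremum of τ(x) / ∣x∣ is c.
  IsCompetitiveRatio : Strategy → Carrier → Set
  IsCompetitiveRatio σ c =
    (∀ x → 1# ≤ ∣ x ∣ → ∃ (IsDetectionTime σ x)) × IsSup (Ratio σ) c

  zigzag : Carrier → Strategy
  zigzag a i =
      to (- 1#) ^ suc i * a ^ᶻ (+ i ℤ.- + 2) at full
    ∷ to (- 1#) ^ suc i * a ^ i at slow
    ∷ to 0# at full
    ∷ []

{-# OPTIONS --safe #-}
-- Put s = a - 1 and w = 1/v. Then s²(1 + w) = 2, so √(2 + 2w) = 2/s and the claimed ratio C
-- satisfies sC = a² + a + (a² - 1)w. If round i starts at time T i, this makes
-- C aⁱ⁻² - (T i + aⁱ⁻²) independent of i: the slow sweep of every round starts earlier than C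
-- times its distance, by the same slack. A target is detected in the first round whose slow
-- sweep contains it, and w ≤ C, so its ratio stays below C. Conversely, a target just beyond
-- distance aⁿ, on the side of round n, has to wait for round n + 2, and its ratio tends to C
-- because the slack is negligible against aⁿ.
module Submission where

open import Defs
open import Data.Empty using (⊥-elim)
open import Data.Integer.Base as ℤ using (+_)
open import Data.Nat.Base as ℕ using (ℕ; zero; suc)
open import Data.Nat.Induction using (<-rec)
import Data.Nat.Properties as ℕₚ
open import Data.Product.Base using (∃; _×_; _,_; proj₁; proj₂)
open import Data.Sum.Base using (_⊎_; inj₁; inj₂)
open import Relation.Binary.Bundles using (StrictTotalOrder)
open import Relation.Binary.Definitions using (tri<; tri≈; tri>)
open import Relation.Binary.PropositionalEquality.Core as ≡ using (_≡_)
open import Relation.Nullary using (¬_; Dec; yes; no; _×-dec_)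
import Algebra.Properties.AbelianGroup as AbelianGroupProperties
import Algebra.Properties.Ring as RingProperties
import Algebra.Solver.Ring.NaturalCoefficients.Default as Solver

-- A bounded search below the known witness either finds a smaller one, on which to recurse, or
-- proves minimality. This will single out the first round that covers a target.
least : ∀ {P : ℕ → Set} → (∀ n → Dec (P n)) → ∀ n → P n →
        ∃ λ m → P m × (∀ k → k ℕ.< m → ¬ P k)
least {P} P? = <-rec _ step
  where
  step : ∀ n → (∀ {k} → k ℕ.< n → P k → ∃ λ m → P m × (∀ k → k ℕ.< m → ¬ P k)) →
         P n → ∃ λ m → P m × (∀ k → k ℕ.< m → ¬ P k)
  step n rec Pn with ℕₚ.anyUpTo? P? n
  ... | yes (k , k<n , Pk) = rec k<n Pk
  ... | no none            = n , Pn , λ k k<n Pk → none (k , k<n , Pk)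

-- Order, multiplication and division in an ordered field.

module OrderedFieldProperties (F : OrderedField) where
  open OrderedField F
  open Solver commutativeSemiring public using (solve; _:=_; _:+_; _:*_; con)
  open AbelianGroupProperties +-abelianGroup using (xyx⁻¹≈y)
  open import Relation.Binary.Reasoning.StrictPartialOrder
    (StrictTotalOrder.strictPartialOrder strictTotalOrder) public
  open import Relation.Binary.Properties.StrictTotalOrder strictTotalOrder public
    using () renaming (_≤?_ to infix 4 _≤?_)

  ≤-refl : ∀ {x} → x ≤ x
  ≤-refl = inj₂ refl

  ≤-trans : ∀ {x y z} → x ≤ y → y ≤ z → x ≤ z
  ≤-trans {x} {y} {z} p q = begin
    x  ≤⟨ p ⟩
    y  ≤⟨ q ⟩
    z  ∎

  <⇒≱ : ∀ {x y} → x < y → ¬ y ≤ x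
  <⇒≱ p (inj₁ q) = asym p q
  <⇒≱ p (inj₂ q) = irrefl (sym q) p

  ≮⇒≥ : ∀ {x y} → ¬ x < y → y ≤ x
  ≮⇒≥ {x} {y} p with compare x y
  ... | tri< q _ _ = ⊥-elim (p q)
  ... | tri≈ _ q _ = inj₂ (sym q)
  ... | tri> _ _ q = inj₁ q

  ≰⇒> : ∀ {x y} → ¬ x ≤ y → y < x
  ≰⇒> {x} {y} p with compare x y
  ... | tri< q _ _ = ⊥-elim (p (inj₁ q))
  ... | tri≈ _ q _ = ⊥-elim (p (inj₂ q))
  ... | tri> _ _ q = q

  +-monoʳ-< : ∀ z {x y} → x < y → z + x < z + y
  +-monoʳ-< z {x} {y} p = begin-strict
    z + x  ≈⟨ +-comm z x ⟩
    x + z  <⟨ +-monoˡ-< z p ⟩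
    y + z  ≈⟨ +-comm y z ⟩
    z + y  ∎

  +-monoˡ-≤ : ∀ z {x y} → x ≤ y → x + z ≤ y + z
  +-monoˡ-≤ z (inj₁ p) = inj₁ (+-monoˡ-< z p)
  +-monoˡ-≤ z (inj₂ p) = inj₂ (+-congʳ p)

  +-monoʳ-≤ : ∀ z {x y} → x ≤ y → z + x ≤ z + y
  +-monoʳ-≤ z (inj₁ p) = inj₁ (+-monoʳ-< z p)
  +-monoʳ-≤ z (inj₂ p) = inj₂ (+-congˡ p)

  +-mono-≤ : ∀ {x y z w} → x ≤ y → z ≤ w → x + z ≤ y + w
  +-mono-≤ {y = y} {z} p q = ≤-trans (+-monoˡ-≤ z p) (+-monoʳ-≤ y q)

  +-cancelʳ-< : ∀ z {x y} → x + z < y + z → x < y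
  +-cancelʳ-< z {x} {y} p with compare x y
  ... | tri< q _ _ = q
  ... | tri≈ _ q _ = ⊥-elim (irrefl (+-congʳ q) p)
  ... | tri> _ _ q = ⊥-elim (asym (+-monoˡ-< z q) p)

  x≤x+y : ∀ x {y} → 0# ≤ y → x ≤ x + y
  x≤x+y x {y} p = begin
    x       ≈⟨ +-identityʳ x ⟨
    x + 0#  ≤⟨ +-monoʳ-≤ x p ⟩
    x + y   ∎

  x<x+y : ∀ x {y} → 0# < y → x < x + y
  x<x+y x {y} p = begin-strict
    x       ≈⟨ +-identityʳ x ⟨
    x + 0#  <⟨ +-monoʳ-< x p ⟩
    x + y   ∎

  +-pos : ∀ {x y} → 0# < x → 0# < y → 0# < x + y
  +-pos p q = <-trans p (x<x+y _ q)

  x+[y-x]≈y : ∀ x y → x + (y - x) ≈ y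
  x+[y-x]≈y x y = trans (sym (+-assoc x y (- x))) (xyx⁻¹≈y x y)

  y≈x+d⇒y-x≈d : ∀ {x y d} → y ≈ x + d → y - x ≈ d
  y≈x+d⇒y-x≈d {x} {_} {d} p = trans (+-congʳ p) (xyx⁻¹≈y x d)

  x<y⇒0<y-x : ∀ {x y} → x < y → 0# < y - x
  x<y⇒0<y-x {x} p = <-respˡ-≈ (-‿inverseʳ x) (+-monoˡ-< (- x) p)

  x≤y⇒0≤y-x : ∀ {x y} → x ≤ y → 0# ≤ y - x
  x≤y⇒0≤y-x (inj₁ p) = inj₁ (x<y⇒0<y-x p)
  x≤y⇒0≤y-x {x} (inj₂ p) = inj₂ (trans (sym (-‿inverseʳ x)) (+-congʳ p))

  pos⇒≉0 : ∀ {x} → 0# < x → ¬ x ≈ 0#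
  pos⇒≉0 p q = irrefl (sym q) p

  *-monoˡ-< : ∀ {z} → 0# < z → ∀ {x y} → x < y → x * z < y * z
  *-monoˡ-< {z} 0<z {x} {y} p = begin-strict
    x * z                ≈⟨ +-identityʳ _ ⟨
    x * z + 0#           <⟨ +-monoʳ-< _ (*-pos (x<y⇒0<y-x p) 0<z) ⟩
    x * z + (y - x) * z  ≈⟨ distribʳ z x (y - x) ⟨
    (x + (y - x)) * z    ≈⟨ *-congʳ (x+[y-x]≈y x y) ⟩
    y * z                ∎

  *-monoˡ-≤ : ∀ {z} → 0# ≤ z → ∀ {x y} → x ≤ y → x * z ≤ y * z
  *-monoˡ-≤ (inj₁ p) (inj₁ q) = inj₁ (*-monoˡ-< p q)
  *-monoˡ-≤ (inj₁ p) (inj₂ q) = inj₂ (*-congʳ q)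
  *-monoˡ-≤ {z} (inj₂ p) {x} {y} q = inj₂ (begin-equality
    x * z   ≈⟨ *-congˡ p ⟨
    x * 0#  ≈⟨ zeroʳ x ⟩
    0#      ≈⟨ zeroʳ y ⟨
    y * 0#  ≈⟨ *-congˡ p ⟩
    y * z   ∎)

  *-nonneg : ∀ {x y} → 0# ≤ x → 0# ≤ y → 0# ≤ x * y
  *-nonneg {x} {y} p q = begin
    0#      ≈⟨ zeroˡ y ⟨
    0# * y  ≤⟨ *-monoˡ-≤ q p ⟩
    x * y   ∎

  *-cancelʳ-< : ∀ {z} → 0# < z → ∀ {x y} → x * z < y * z → x < y
  *-cancelʳ-< 0<z {x} {y} p with compare x y
  ... | tri< q _ _ = q
  ... | tri≈ _ q _ = ⊥-elim (irrefl (*-congʳ q) p)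
  ... | tri> _ _ q = ⊥-elim (asym (*-monoˡ-< 0<z q) p)

  *-cancelʳ-≤ : ∀ {z} → 0# < z → ∀ {x y} → x * z ≤ y * z → x ≤ y
  *-cancelʳ-≤ 0<z p = ≮⇒≥ (λ q → <⇒≱ (*-monoˡ-< 0<z q) p)

  square-injective : ∀ {x y} → 0# ≤ x → 0# < y → x * x ≈ y * y → x ≈ y
  square-injective {x} {y} 0≤x 0<y p with compare x y
  ... | tri< q _ _ = ⊥-elim (irrefl p (begin-strict
    x * x  ≤⟨ *-monoˡ-≤ 0≤x (inj₁ q) ⟩
    y * x  ≈⟨ *-comm y x ⟩
    x * y  <⟨ *-monoˡ-< 0<y q ⟩
    y * y  ∎))
  ... | tri≈ _ q _ = q
  ... | tri> _ _ q = ⊥-elim (irrefl (sym p) (begin-strict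
    y * y  <⟨ *-monoˡ-< 0<y q ⟩
    x * y  ≈⟨ *-comm x y ⟩
    y * x  ≤⟨ *-monoˡ-≤ 0≤x (inj₁ q) ⟩
    x * x  ∎))

  x*y/y≈x : ∀ x {y} → 0# < y → x * y / y ≈ x
  x*y/y≈x x {y} p = trans (*-assoc x y _) (trans (*-congˡ (⁻¹-inverseʳ (pos⇒≉0 p))) (*-identityʳ x))

  x/y*y≈x : ∀ x {y} → 0# < y → x / y * y ≈ x
  x/y*y≈x x {y} p = begin-equality
    x * y ⁻¹ * y  ≈⟨ solve 3 (λ x y z → x :* z :* y := x :* y :* z) refl x y (y ⁻¹) ⟩
    x * y / y     ≈⟨ x*y/y≈x x p ⟩
    x             ∎

  ⁻¹-pos : ∀ {x} → 0# < x → 0# < x ⁻¹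
  ⁻¹-pos {x} p = *-cancelʳ-< p (begin-strict
    0# * x    ≈⟨ zeroˡ x ⟩
    0#        <⟨ 0<1 ⟩
    1#        ≈⟨ ⁻¹-inverseʳ (pos⇒≉0 p) ⟨
    x * x ⁻¹  ≈⟨ *-comm x _ ⟩
    x ⁻¹ * x  ∎)

  x/1≈x : ∀ x → x / 1# ≈ x
  x/1≈x x = trans (*-congʳ (sym (*-identityʳ x))) (x*y/y≈x x 0<1)

-- Consequences of completeness: excluded middle and unbounded powers.

module CompleteOrderedFieldProperties (ℝ : CompleteOrderedField) where
  open CompleteOrderedField ℝ
  open RealFunctions ℝ
  open OrderedFieldProperties orderedField
  open RingProperties ring using (-1*x≈-x)
  open AbelianGroupProperties +-abelianGroup using (ε⁻¹≈ε; ⁻¹-involutive)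

  -- The supremum of { 0 } ∪ { 1 ∣ A } decides A.
  excluded-middle : ∀ (A : Set) → Dec A
  excluded-middle A with complete P (0# , inj₁ refl) (1# , bounded)
    where
    P : Carrier → Set
    P x = x ≈ 0# ⊎ (A × x ≈ 1#)
    bounded : IsUpperBound P 1#
    bounded x (inj₁ p) = inj₁ (<-respˡ-≈ (sym p) 0<1)
    bounded x (inj₂ (_ , p)) = inj₂ p
  ... | σ , isSup with compare 0# σ
  ...   | tri≈ _ p _ = no λ x → <⇒≱ 0<1 (≤-trans (IsSup.upperBound isSup 1# (inj₂ (x , refl))) (inj₂ (sym p)))
  ...   | tri> _ _ p = no λ x → <⇒≱ 0<1 (≤-trans (IsSup.upperBound isSup 1# (inj₂ (x , refl))) (inj₁ p))
  ...   | tri< p _ _ with IsSup.approached isSup 0# p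
  ...     | x , inj₁ q , r       = ⊥-elim (irrefl (sym q) r)
  ...     | x , inj₂ (y , _) , _ = yes y

  ^-pos : ∀ {x} → 0# < x → ∀ n → 0# < x ^ n
  ^-pos p zero    = 0<1
  ^-pos p (suc n) = *-pos p (^-pos p n)

  1≤[1+s]^n : ∀ {s} → 0# < s → ∀ n → 1# ≤ (1# + s) ^ n
  1≤[1+s]^n p zero = ≤-refl
  1≤[1+s]^n {s} p (suc n) = begin
    1#                                 ≤⟨ 1≤[1+s]^n p n ⟩
    (1# + s) ^ n                       ≤⟨ x≤x+y _ (inj₁ (*-pos p (^-pos (+-pos 0<1 p) n))) ⟩
    (1# + s) ^ n + s * (1# + s) ^ n
      ≈⟨ solve 2 (λ s x → x :+ s :* x := (con 1 :+ s) :* x) refl s ((1# + s) ^ n) ⟩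
    (1# + s) ^ suc n                   ∎

  -- If the powers were bounded, some power would exceed `σ - s`, with `σ` their supremum. Powers
  -- are at least 1, so one more factor `1# + s` adds at least `s` and leads beyond `σ`.
  archimedean : ∀ {s} → 0# < s → ∀ b → ∃ λ n → b < (1# + s) ^ n
  archimedean {s} 0<s b with excluded-middle (∃ λ n → b < (1# + s) ^ n)
  ... | yes p = p
  ... | no p with complete (λ x → ∃ λ n → x ≈ (1# + s) ^ n) (1# , 0 , refl)
                    (b , λ { x (n , q) → ≤-trans (inj₂ q) (≮⇒≥ (λ r → p (n , r))) })
  ...   | σ , isSup with IsSup.approached isSup (σ - s) σ-s<σ
    where
    σ-s<σ : σ - s < σ
    σ-s<σ = begin-strict
      σ - s        <⟨ x<x+y _ 0<s ⟩
      σ - s + s    ≈⟨ +-comm _ s ⟩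
      s + (σ - s)  ≈⟨ x+[y-x]≈y s σ ⟩
      σ            ∎
  ...     | x , (n , x≈) , σ-s<x = ⊥-elim (<⇒≱ σ<power (IsSup.upperBound isSup _ (suc n , refl)))
    where
    σ<power : σ < (1# + s) ^ suc n
    σ<power = begin-strict
      σ                                ≈⟨ x+[y-x]≈y s σ ⟨
      s + (σ - s)                      <⟨ +-monoʳ-< s σ-s<x ⟩
      s + x                            ≈⟨ +-congˡ x≈ ⟩
      s + (1# + s) ^ n                 ≈⟨ +-congʳ (*-identityˡ s) ⟨
      1# * s + (1# + s) ^ n            ≤⟨ +-monoˡ-≤ _ (*-monoˡ-≤ (inj₁ 0<s) (1≤[1+s]^n 0<s n)) ⟩
      (1# + s) ^ n * s + (1# + s) ^ n
        ≈⟨ solve 2 (λ s x → x :* s :+ x := (con 1 :+ s) :* x) refl s ((1# + s) ^ n) ⟩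
      (1# + s) ^ suc n                 ∎

  -- Absolute values and the two sides of the line.

  neg-nonneg : ∀ {x} → 0# ≤ - x → x ≤ 0#
  neg-nonneg {x} p = begin
    x          ≤⟨ x≤x+y x p ⟩
    x + (- x)  ≈⟨ -‿inverseʳ x ⟩
    0#         ∎

  0≤x⇒∣x∣≈x : ∀ {x} → 0# ≤ x → ∣ x ∣ ≈ x
  0≤x⇒∣x∣≈x {x} p with compare x 0#
  ... | tri< q _ _ = ⊥-elim (<⇒≱ q p)
  ... | tri≈ _ _ _ = refl
  ... | tri> _ _ _ = refl

  0≤-x⇒∣x∣≈-x : ∀ {x} → 0# ≤ - x → ∣ x ∣ ≈ - x
  0≤-x⇒∣x∣≈-x {x} p with compare x 0#
  ... | tri< _ _ _ = refl
  ... | tri≈ _ q _ = trans q (sym (trans (-‿cong q) ε⁻¹≈ε))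
  ... | tri> _ _ q = ⊥-elim (<⇒≱ q (neg-nonneg p))

  x≈∣x∣⊎-x≈∣x∣ : ∀ x → x ≈ ∣ x ∣ ⊎ - x ≈ ∣ x ∣
  x≈∣x∣⊎-x≈∣x∣ x with compare x 0#
  ... | tri< _ _ _ = inj₂ refl
  ... | tri≈ _ _ _ = inj₁ refl
  ... | tri> _ _ _ = inj₁ refl

  -- The sign in front of the destinations of round i in `zigzag`. The equation `sign i * x ≈ ∣ x ∣`
  -- serves as the statement that x lies on the side swept by round i.
  sign : ℕ → Carrier
  sign i = (- 1#) ^ suc i

  sign≈±1 : ∀ i → sign i ≈ 1# ⊎ sign i ≈ - 1#
  sign≈±1 zero = inj₂ (*-identityʳ _)
  sign≈±1 (suc i) with sign≈±1 i
  ... | inj₁ p = inj₂ (trans (*-congˡ p) (*-identityʳ _))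
  ... | inj₂ p = inj₁ (trans (*-congˡ p) (trans (-1*x≈-x _) (⁻¹-involutive 1#)))

  sign-suc-* : ∀ i x → sign (suc i) * x ≈ - (sign i * x)
  sign-suc-* i x = trans (*-assoc _ _ x) (-1*x≈-x _)

  sign-+2-* : ∀ i x → sign (suc (suc i)) * x ≈ sign i * x
  sign-+2-* i x = trans (sign-suc-* (suc i) x) (trans (-‿cong (sign-suc-* i x)) (⁻¹-involutive _))

  sign-*-involutive : ∀ i x → sign i * (sign i * x) ≈ x
  sign-*-involutive i x with sign≈±1 i
  ... | inj₁ p = trans (*-congʳ p) (trans (*-identityˡ _) (trans (*-congʳ p) (*-identityˡ x)))
  ... | inj₂ p = trans (*-congʳ p) (trans (-1*x≈-x _)
    (trans (-‿cong (trans (*-congʳ p) (-1*x≈-x x))) (⁻¹-involutive x)))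

  -- The sign is 1 or -1, so x is r or -r. The durations and distances below are evaluated this way,
  -- without comparing positions.
  ∣x∣≈r : ∀ i {x r} → 0# ≤ r → sign i * x ≈ r → ∣ x ∣ ≈ r
  ∣x∣≈r i {x} {r} 0≤r p with sign≈±1 i
  ... | inj₁ q = trans (0≤x⇒∣x∣≈x (≤-trans 0≤r (inj₂ (sym x≈r)))) x≈r
    where
    x≈r : x ≈ r
    x≈r = trans (sym (*-identityˡ x)) (trans (*-congʳ (sym q)) p)
  ... | inj₂ q = trans (0≤-x⇒∣x∣≈-x (≤-trans 0≤r (inj₂ (sym -x≈r)))) -x≈r
    where
    -x≈r : - x ≈ r
    -x≈r = trans (sym (-1*x≈-x x)) (trans (*-congʳ (sym q)) p)

  side : ∀ i x → sign i * x ≈ ∣ x ∣ ⊎ sign (suc i) * x ≈ ∣ x ∣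
  side i x with x≈∣x∣⊎-x≈∣x∣ x | sign≈±1 i
  ... | inj₁ p | inj₁ q = inj₁ (trans (*-congʳ q) (trans (*-identityˡ x) p))
  ... | inj₂ p | inj₂ q = inj₁ (trans (*-congʳ q) (trans (-1*x≈-x x) p))
  ... | inj₁ p | inj₂ q = inj₂ (trans (sign-suc-* i x)
    (trans (-‿cong (trans (*-congʳ q) (-1*x≈-x x))) (trans (⁻¹-involutive x) p)))
  ... | inj₂ p | inj₁ q = inj₂ (trans (sign-suc-* i x)
    (trans (-‿cong (trans (*-congʳ q) (*-identityˡ x))) p))

  -- Consecutive signs are opposite, so `∣ x ∣ + ∣ x ∣` would vanish.
  one-side : ∀ i {x} → 0# < ∣ x ∣ → sign i * x ≈ ∣ x ∣ → ¬ sign (suc i) * x ≈ ∣ x ∣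
  one-side i {x} 0<∣x∣ p q = irrefl
    (sym (trans (sym (+-congʳ p)) (trans (+-congˡ (trans (sym q) (sign-suc-* i x))) (-‿inverseʳ _))))
    (+-pos 0<∣x∣ 0<∣x∣)

-- The zigzag strategy with an arbitrary expansion factor 1 + s, s > 0.

module Zigzag (ℝ : CompleteOrderedField) (v s : CompleteOrderedField.Carrier ℝ)
              (0<v : CompleteOrderedField._<_ ℝ (CompleteOrderedField.0# ℝ) v)
              (0<s : CompleteOrderedField._<_ ℝ (CompleteOrderedField.0# ℝ) s) where
  open CompleteOrderedField ℝ
  open RealFunctions ℝ
  open Search ℝ v
  open State
  open OrderedFieldProperties orderedField
  open CompleteOrderedFieldProperties ℝ
  open RingProperties ring using (x[y-z]≈xy-xz)

  -- `g` is a² - 1, expanded in `s` without subtraction so that the semiring solver can handle it.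
  w a g : Carrier
  w = v ⁻¹
  a = 1# + s
  g = s + s + s * s

  σ : Strategy
  σ = zigzag a

  -- In distances from the origin, the slow sweep of round i begins at `near i` and has length
  -- `gap i`; the round begins at time `T i`.
  near gap T : ℕ → Carrier
  near i = a ^ᶻ (+ i ℤ.- + 2)
  gap i  = near i * g
  T i    = time (roundStart σ i)

  0<w : 0# < w
  0<w = ⁻¹-pos 0<v

  0<a : 0# < a
  0<a = +-pos 0<1 0<s

  0<g : 0# < g
  0<g = +-pos (+-pos 0<s 0<s) (*-pos 0<s 0<s)

  -- The exponent i - 2 is negative in the first two rounds, where the inverse of `a` must be
  -- cancelled; from round 2 on both sides agree by computation.
  near-suc : ∀ i → near (suc i) ≈ a * near i
  near-suc 0 = begin-equality
    a ⁻¹ * 1#             ≈⟨ *-congʳ (*-identityˡ _) ⟨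
    1# * a ⁻¹ * 1#        ≈⟨ *-congʳ (*-congʳ (⁻¹-inverseʳ (pos⇒≉0 0<a))) ⟨
    a * a ⁻¹ * a ⁻¹ * 1#
      ≈⟨ solve 2 (λ a b → a :* b :* b :* con 1 := a :* (b :* (b :* con 1))) refl a (a ⁻¹) ⟩
    a * near 0            ∎
  near-suc 1 = sym (trans (*-congˡ (*-identityʳ _)) (⁻¹-inverseʳ (pos⇒≉0 0<a)))
  near-suc (suc (suc i)) = refl

  near+gap : ∀ i → near i + gap i ≈ a ^ i
  near+gap i = begin-equality
    near i + gap i
      ≈⟨ solve 2 (λ s y → y :+ y :* (s :+ s :+ s :* s) := (con 1 :+ s) :* ((con 1 :+ s) :* y))
               refl s (near i) ⟩
    a * (a * near i)    ≈⟨ *-congˡ (near-suc i) ⟨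
    a * near (suc i)    ≈⟨ near-suc (suc i) ⟨
    a ^ i               ∎

  0<near : ∀ i → 0# < near i
  0<near 0 = ^-pos (⁻¹-pos 0<a) 2
  0<near 1 = ^-pos (⁻¹-pos 0<a) 1
  0<near (suc (suc i)) = ^-pos 0<a i

  0<gap : ∀ i → 0# < gap i
  0<gap i = *-pos (0<near i) 0<g

  -- As `near (suc (suc i))` computes to `a ^ i`, this and `near-mono` also serve to compare turning
  -- points.
  near≤near-suc : ∀ i → near i ≤ near (suc i)
  near≤near-suc i = begin
    near i               ≤⟨ x≤x+y _ (inj₁ (*-pos 0<s (0<near i))) ⟩
    near i + s * near i  ≈⟨ solve 2 (λ s y → y :+ s :* y := (con 1 :+ s) :* y) refl s (near i) ⟩
    a * near i           ≈⟨ near-suc i ⟨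
    near (suc i)         ∎

  near-mono : ∀ {i j} → i ℕ.≤′ j → near i ≤ near j
  near-mono (ℕ.≤′-reflexive ≡.refl) = ≤-refl
  near-mono {j = suc j} (ℕ.≤′-step p) = ≤-trans (near-mono p) (near≤near-suc j)

  -- Durations of the three moves of a round.

  position≡0 : ∀ i → position (roundStart σ i) ≡ 0#
  position≡0 zero    = ≡.refl
  position≡0 (suc i) = ≡.refl

  ∣sign*r∣≈r : ∀ i {r} → 0# ≤ r → ∣ sign i * r ∣ ≈ r
  ∣sign*r∣≈r i p = ∣x∣≈r i p (sign-*-involutive i _)

  approach-duration : ∀ i → ∣ sign i * near i - position (roundStart σ i) ∣ / 1# ≈ near i
  approach-duration i rewrite position≡0 i = trans (x/1≈x _) (∣x∣≈r i (inj₁ (0<near i)) (begin-equality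
    sign i * (sign i * near i - 0#)
      ≈⟨ *-congˡ (y≈x+d⇒y-x≈d (sym (+-identityˡ _))) ⟩
    sign i * (sign i * near i)       ≈⟨ sign-*-involutive i _ ⟩
    near i                           ∎))

  sweep-displacement : ∀ i → sign i * a ^ i - sign i * near i ≈ sign i * gap i
  sweep-displacement i = trans (sym (x[y-z]≈xy-xz _ _ _)) (*-congˡ (y≈x+d⇒y-x≈d (sym (near+gap i))))

  sweep-duration : ∀ i → ∣ sign i * a ^ i - sign i * near i ∣ / v ≈ gap i * w
  sweep-duration i = *-congʳ (∣x∣≈r i (inj₁ (0<gap i))
    (trans (*-congˡ (sweep-displacement i)) (sign-*-involutive i _)))

  -- The way back points towards the opposite side, hence the sign of the next round.
  return-duration : ∀ i → ∣ 0# - sign i * a ^ i ∣ / 1# ≈ a ^ i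
  return-duration i = trans (x/1≈x _) (∣x∣≈r (suc i) (inj₁ (^-pos 0<a i)) (begin-equality
    sign (suc i) * (0# - sign i * a ^ i)  ≈⟨ *-congˡ (+-identityˡ _) ⟩
    sign (suc i) * - (sign i * a ^ i)     ≈⟨ *-congˡ (sign-suc-* i _) ⟨
    sign (suc i) * (sign (suc i) * a ^ i) ≈⟨ sign-*-involutive (suc i) _ ⟩
    a ^ i                                 ∎))

  T-suc : ∀ i → T (suc i) ≈ T i + near i + gap i * w + a ^ i
  T-suc i = +-cong (+-cong (+-congˡ (approach-duration i)) (sweep-duration i)) (return-duration i)

  -- Slow passes, described by the distance covered within the sweep.

  record Pass (x t : Carrier) (i : ℕ) : Set where
    field
      offset    : Carrier
      0≤offset  : 0# ≤ offset
      offset≤   : offset ≤ gap i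
      same-side : sign i * x ≈ ∣ x ∣
      distance  : ∣ x ∣ ≈ near i + offset
      arrival   : t ≈ T i + near i + offset * w

  -- The first and third moves are at full speed, so only the second can contain a slow pass. Its
  -- completed fraction θ becomes the offset `θ * gap i` from the near end of the sweep.
  slowPass⇒pass : ∀ {x t} i → SlowPass x t (roundStart σ i) (σ i) → Pass x t i
  slowPass⇒pass i (here () _)
  slowPass⇒pass i (there (there (here () _)))
  slowPass⇒pass i (there (there (there ())))
  slowPass⇒pass {x} {t} i (there (here ≡.refl (θ , 0≤θ , θ≤1 , x≈ , t≈))) = record
    { offset    = θ * gap i
    ; 0≤offset  = 0≤u
    ; offset≤   = ≤-trans (*-monoˡ-≤ (inj₁ (0<gap i)) θ≤1) (inj₂ (*-identityˡ _))
    ; same-side = trans signed (sym distance)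
    ; distance  = distance
    ; arrival   = begin-equality
        t                                     ≈⟨ t≈ ⟩
        _                                     ≈⟨ +-cong (+-congˡ (approach-duration i)) (*-congˡ (sweep-duration i)) ⟩
        T i + near i + θ * (gap i * w)        ≈⟨ +-congˡ (*-assoc _ _ _) ⟨
        T i + near i + θ * gap i * w          ∎
    }
    where
    0≤u : 0# ≤ θ * gap i
    0≤u = *-nonneg 0≤θ (inj₁ (0<gap i))
    signed : sign i * x ≈ near i + θ * gap i
    signed = begin-equality
      sign i * x                                         ≈⟨ *-congˡ x≈ ⟩
      sign i * (sign i * near i + θ * (sign i * a ^ i - sign i * near i))
        ≈⟨ *-congˡ (+-congˡ (*-congˡ (sweep-displacement i))) ⟩
      sign i * (sign i * near i + θ * (sign i * gap i))
        ≈⟨ solve 4 (λ e y θ d → e :* (e :* y :+ θ :* (e :* d)) := e :* (e :* (y :+ θ :* d)))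
                 refl (sign i) (near i) θ (gap i) ⟩
      sign i * (sign i * (near i + θ * gap i))           ≈⟨ sign-*-involutive i _ ⟩
      near i + θ * gap i                                 ∎
    distance : ∣ x ∣ ≈ near i + θ * gap i
    distance = ∣x∣≈r i (≤-trans (inj₁ (0<near i)) (x≤x+y _ 0≤u)) signed

  pass⇒slowPass : ∀ {x t} i → Pass x t i → SlowPass x t (roundStart σ i) (σ i)
  pass⇒slowPass {x} {t} i p = there (here ≡.refl (θ , 0≤θ , θ≤1 , x≈ , t≈))
    where
    open Pass p
    θ : Carrier
    θ = offset / gap i
    θ*gap≈offset : θ * gap i ≈ offset
    θ*gap≈offset = x/y*y≈x _ (0<gap i)
    0≤θ : 0# ≤ θ
    0≤θ = *-nonneg 0≤offset (inj₁ (⁻¹-pos (0<gap i)))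
    θ≤1 : θ ≤ 1#
    θ≤1 = *-cancelʳ-≤ (0<gap i) (begin
      θ * gap i   ≈⟨ θ*gap≈offset ⟩
      offset      ≤⟨ offset≤ ⟩
      gap i       ≈⟨ *-identityˡ _ ⟨
      1# * gap i  ∎)
    x≈ : x ≈ sign i * near i + θ * (sign i * a ^ i - sign i * near i)
    x≈ = begin-equality
      x                                         ≈⟨ sign-*-involutive i x ⟨
      sign i * (sign i * x)                     ≈⟨ *-congˡ (trans same-side distance) ⟩
      sign i * (near i + offset)                ≈⟨ *-congˡ (+-congˡ θ*gap≈offset) ⟨
      sign i * (near i + θ * gap i)
        ≈⟨ solve 4 (λ e y θ d → e :* (y :+ θ :* d) := e :* y :+ θ :* (e :* d))
                 refl (sign i) (near i) θ (gap i) ⟩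
      sign i * near i + θ * (sign i * gap i)    ≈⟨ +-congˡ (*-congˡ (sweep-displacement i)) ⟨
      sign i * near i + θ * (sign i * a ^ i - sign i * near i)  ∎
    t≈ : t ≈ T i + ∣ sign i * near i - position (roundStart σ i) ∣ / 1#
               + θ * (∣ sign i * a ^ i - sign i * near i ∣ / v)
    t≈ = begin-equality
      t                                ≈⟨ arrival ⟩
      T i + near i + offset * w        ≈⟨ +-congˡ (*-congʳ θ*gap≈offset) ⟨
      T i + near i + θ * gap i * w     ≈⟨ +-congˡ (*-assoc _ _ _) ⟩
      T i + near i + θ * (gap i * w)   ≈⟨ +-cong (+-congˡ (approach-duration i)) (*-congˡ (sweep-duration i)) ⟨
      _                                ∎

  -- Order of the passes in time and the first detection.

  T≤T-suc : ∀ i → T i ≤ T (suc i)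
  T≤T-suc i = begin
    T i                                        ≤⟨ x≤x+y _ (inj₁ (0<near i)) ⟩
    T i + near i                               ≤⟨ x≤x+y _ (inj₁ (*-pos (0<gap i) 0<w)) ⟩
    T i + near i + gap i * w                   ≤⟨ x≤x+y _ (inj₁ (^-pos 0<a i)) ⟩
    T i + near i + gap i * w + a ^ i           ≈⟨ T-suc i ⟨
    T (suc i)                                  ∎

  T-mono : ∀ {i j} → i ℕ.≤′ j → T i ≤ T j
  T-mono (ℕ.≤′-reflexive ≡.refl) = ≤-refl
  T-mono {j = suc j} (ℕ.≤′-step p) = ≤-trans (T-mono p) (T≤T-suc j)

  pass≥ : ∀ {x t i} → Pass x t i → T i + near i ≤ t
  pass≥ p = ≤-trans (x≤x+y _ (*-nonneg (Pass.0≤offset p) (inj₁ 0<w))) (inj₂ (sym (Pass.arrival p)))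

  -- Together with `pass≥` this confines a pass to the time span of its round, so passes in
  -- different rounds are ordered like the rounds.
  pass≤ : ∀ {x t i} → Pass x t i → t ≤ T (suc i)
  pass≤ {x} {t} {i} p = begin
    t                                  ≈⟨ arrival ⟩
    T i + near i + offset * w          ≤⟨ +-monoʳ-≤ _ (*-monoˡ-≤ (inj₁ 0<w) offset≤) ⟩
    T i + near i + gap i * w           ≤⟨ x≤x+y _ (inj₁ (^-pos 0<a i)) ⟩
    T i + near i + gap i * w + a ^ i   ≈⟨ T-suc i ⟨
    T (suc i)                          ∎
    where open Pass p

  -- Only the far end of the sweep is tested. In the first covering round the bound at the near end
  -- follows by `near≤∣x∣`.
  Covers : Carrier → ℕ → Set
  Covers x i = sign i * x ≈ ∣ x ∣ × ∣ x ∣ ≤ a ^ i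

  covers? : ∀ x i → Dec (Covers x i)
  covers? x i = (sign i * x ≟ ∣ x ∣) ×-dec (∣ x ∣ ≤? a ^ i)
    where open StrictTotalOrder strictTotalOrder using (_≟_)

  pass⇒covers : ∀ {x t i} → Pass x t i → Covers x i
  pass⇒covers {i = i} p = same-side , ≤-trans (inj₂ distance) (≤-trans (+-monoʳ-≤ _ offset≤) (inj₂ (near+gap i)))
    where open Pass p

  -- Some turning point lies beyond x; if that round is on the wrong side, the next one is on the
  -- right side and goes further.
  covered : ∀ x → ∃ (Covers x)
  covered x with archimedean 0<s ∣ x ∣
  ... | n , p with side n x
  ...   | inj₁ q = n , q , inj₁ p
  ...   | inj₂ q = suc n , q , inj₁ (begin-strict
    ∣ x ∣                 <⟨ p ⟩
    a ^ n                 ≤⟨ near≤near-suc (suc (suc n)) ⟩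
    a ^ suc n             ∎)

  -- Round i - 2 is on the same side and turns exactly where the sweep of round i begins; not
  -- covering x, it turned too early. Rounds 0 and 1 have no such predecessor, but their sweeps
  -- begin within distance 1.
  near≤∣x∣ : ∀ {x} i → 1# ≤ ∣ x ∣ → sign i * x ≈ ∣ x ∣ → (∀ k → k ℕ.< i → ¬ Covers x k) → near i ≤ ∣ x ∣
  near≤∣x∣ 0 1≤∣x∣ _ _ = ≤-trans (near-mono {0} {2} (ℕ.≤′-step (ℕ.≤′-step ℕ.≤′-refl))) 1≤∣x∣
  near≤∣x∣ 1 1≤∣x∣ _ _ = ≤-trans (near-mono {1} {2} (ℕ.≤′-step ℕ.≤′-refl)) 1≤∣x∣
  near≤∣x∣ {x} (suc (suc i)) _ p none = inj₁ (≰⇒> λ q →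
    none i (ℕₚ.m≤n⇒m≤1+n ℕₚ.≤-refl) (trans (sym (sign-+2-* i x)) p , q))

  -- The first covering round contains a pass. A pass in an earlier round would make that round
  -- covering, one in a later round comes later, and one in the same round has the same offset. The
  -- pass is returned too, since both bounds on the ratio need it.
  detection : ∀ x → 1# ≤ ∣ x ∣ → ∃ λ t → IsDetectionTime σ x t × ∃ (Pass x t)
  detection x 1≤∣x∣ with covered x
  ... | n , cov with least (covers? x) n cov
  ...   | i , (p , q) , none = t , ((i , pass⇒slowPass i pass) , minimal) , i , pass
    where
    u t : Carrier
    u = ∣ x ∣ - near i
    t = T i + near i + u * w
    distance : ∣ x ∣ ≈ near i + u
    distance = sym (x+[y-x]≈y (near i) ∣ x ∣)
    pass : Pass x t i
    pass = record
      { offset    = u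
      ; 0≤offset  = x≤y⇒0≤y-x (near≤∣x∣ i 1≤∣x∣ p none)
      ; offset≤   = begin
          ∣ x ∣ - near i    ≤⟨ +-monoˡ-≤ _ q ⟩
          a ^ i - near i    ≈⟨ y≈x+d⇒y-x≈d (sym (near+gap i)) ⟩
          gap i             ∎
      ; same-side = p
      ; distance  = distance
      ; arrival   = refl
      }
    minimal : ∀ t′ → SlowPassAt σ x t′ → t ≤ t′
    minimal t′ (j , sp) with slowPass⇒pass j sp
    ... | pass′ with ℕₚ.<-cmp i j
    ...   | tri< i<j _ _ = begin
      t              ≤⟨ pass≤ pass ⟩
      T (suc i)      ≤⟨ T-mono (ℕₚ.≤⇒≤′ i<j) ⟩
      T j            ≤⟨ x≤x+y _ (inj₁ (0<near j)) ⟩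
      T j + near j   ≤⟨ pass≥ pass′ ⟩
      t′             ∎
    ...   | tri> _ _ j<i = ⊥-elim (none j j<i (pass⇒covers pass′))
    ...   | tri≈ _ ≡.refl _ = inj₂ (begin-equality
      T i + near i + u * w       ≈⟨ +-congˡ (*-congʳ u≈u′) ⟩
      T i + near i + offset * w  ≈⟨ arrival ⟨
      t′                         ∎)
      where
      open Pass pass′ using (offset; arrival) renaming (distance to distance′)
      u≈u′ : u ≈ offset
      u≈u′ = y≈x+d⇒y-x≈d distance′

  -- The competitive ratio as the solution C of a linear equation.

  module CompetitiveRatio (C : Carrier) (w≤C : w ≤ C) (1≤C : 1# ≤ C)
                          (s*C≈ : s * C ≈ a * a + a + g * w) where

    -- The constant of `turning-time`, read off at round 0, which starts at time 0.
    slack : Carrier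
    slack = C * near 0 - near 0

    0≤slack : 0# ≤ slack
    0≤slack = x≤y⇒0≤y-x (begin
      near 0       ≈⟨ *-identityˡ _ ⟨
      1# * near 0  ≤⟨ *-monoˡ-≤ (inj₁ (0<near 0)) 1≤C ⟩
      C * near 0   ∎)

    -- From one round to the next the left side grows by `near i * (a * a + a + g * w)` and the
    -- right side by `near i * (s * C)`; `s*C≈` equates the two.
    turning-time : ∀ i → T i + near i + slack ≈ C * near i
    turning-time zero = trans (+-congʳ (+-identityˡ _)) (x+[y-x]≈y _ _)
    turning-time (suc i) = begin-equality
      T (suc i) + near (suc i) + slack
        ≈⟨ +-congʳ (+-cong (trans (T-suc i) (+-congˡ (sym (near+gap i)))) (near-suc i)) ⟩
      T i + near i + near i * g * w + (near i + near i * g) + a * near i + slack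
        ≈⟨ solve 5 (λ T y s w D → let a = con 1 :+ s ; g = s :+ s :+ s :* s in
                     T :+ y :+ y :* g :* w :+ (y :+ y :* g) :+ a :* y :+ D
                  := T :+ y :+ D :+ y :* (a :* a :+ a :+ g :* w))
                 refl (T i) (near i) s w slack ⟩
      T i + near i + slack + near i * (a * a + a + g * w)
        ≈⟨ +-cong (turning-time i) (*-congˡ (sym s*C≈)) ⟩
      C * near i + near i * (s * C)
        ≈⟨ solve 3 (λ C y s → C :* y :+ y :* (s :* C) := C :* ((con 1 :+ s) :* y)) refl C (near i) s ⟩
      C * (a * near i)   ≈⟨ *-congˡ (near-suc i) ⟨
      C * near (suc i)   ∎

    -- The bound holds where the sweep begins, as the slack is nonnegative; from there each unit of
    -- distance costs time `w`, which is at most `C`.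
    pass≤C∣x∣ : ∀ {x t i} → Pass x t i → t ≤ C * ∣ x ∣
    pass≤C∣x∣ {x} {t} {i} p = begin
      t                                    ≈⟨ arrival ⟩
      T i + near i + offset * w            ≤⟨ +-mono-≤ (x≤x+y _ 0≤slack) (inj₂ (*-comm _ _)) ⟩
      T i + near i + slack + w * offset    ≤⟨ +-mono-≤ (inj₂ (turning-time i)) (*-monoˡ-≤ 0≤offset w≤C) ⟩
      C * near i + C * offset              ≈⟨ distribˡ _ _ _ ⟨
      C * (near i + offset)                ≈⟨ *-congˡ distance ⟨
      C * ∣ x ∣                            ∎
      where open Pass p

    upperBound : IsUpperBound (Ratio σ) C
    upperBound q (x , t , 1≤∣x∣ , (_ , t-least) , q≈) = *-cancelʳ-≤ 0<∣x∣ (begin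
      q * ∣ x ∣           ≈⟨ *-congʳ q≈ ⟩
      t / ∣ x ∣ * ∣ x ∣   ≈⟨ x/y*y≈x t 0<∣x∣ ⟩
      -- Minimality of the given detection time reduces the bound to the constructed pass.
      t                   ≤⟨ t-least t′ (proj₁ (proj₁ (proj₂ det))) ⟩
      t′                  ≤⟨ pass≤C∣x∣ (proj₂ (proj₂ (proj₂ det))) ⟩
      C * ∣ x ∣           ∎)
      where
      det = detection x 1≤∣x∣
      t′ : Carrier
      t′ = proj₁ det
      0<∣x∣ : 0# < ∣ x ∣
      0<∣x∣ = begin-strict
        0#     <⟨ 0<1 ⟩
        1#     ≤⟨ 1≤∣x∣ ⟩
        ∣ x ∣  ∎

    -- Rounds up to n turn back before reaching distance `∣ x ∣`, and round n + 1 is on the other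
    -- side.
    covers⇒late : ∀ {x} n → sign n * x ≈ ∣ x ∣ → a ^ n < ∣ x ∣ → ∀ {j} → Covers x j → suc (suc n) ℕ.≤ j
    covers⇒late {x} n same far {j} (same′ , ∣x∣≤) with ℕₚ.<-cmp (suc n) j
    ... | tri< p _ _ = p
    ... | tri≈ _ ≡.refl _ = ⊥-elim (one-side n (<-trans (^-pos 0<a n) far) same same′)
    ... | tri> _ _ (ℕ.s≤s j≤n) = ⊥-elim (<⇒≱ far (≤-trans ∣x∣≤
      (near-mono {suc (suc j)} {suc (suc n)} (ℕₚ.≤⇒≤′ (ℕ.s≤s (ℕ.s≤s j≤n))))))

    -- Any target beyond the turning point a ^ n, on its side, is met in round n + 2 at the
    -- earliest; the fixed excess s is negligible against a ^ n.
    approached : ∀ b → b < C → ∃ λ q → Ratio σ q × b < q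
    approached b b<C with archimedean 0<s ((b * s + slack) / (C - b))
    ... | n , large = t / ∣ x ∣ , (x , t , 1≤∣x∣ , isDetection , refl) , *-cancelʳ-< 0<∣x∣ (begin-strict
      b * ∣ x ∣          <⟨ +-cancelʳ-< slack below ⟩
      T (suc (suc n)) + a ^ n  ≤⟨ +-mono-≤ (T-mono late) (near-mono late) ⟩
      T i + near i       ≤⟨ pass≥ pass ⟩
      t                  ≈⟨ x/y*y≈x t 0<∣x∣ ⟨
      t / ∣ x ∣ * ∣ x ∣  ∎)
      where
      y x : Carrier
      y = a ^ n
      x = sign n * (y + s)
      0<y+s : 0# < y + s
      0<y+s = +-pos (^-pos 0<a n) 0<s
      ∣x∣≈ : ∣ x ∣ ≈ y + s
      ∣x∣≈ = ∣sign*r∣≈r n (inj₁ 0<y+s)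
      0<∣x∣ : 0# < ∣ x ∣
      0<∣x∣ = <-respʳ-≈ (sym ∣x∣≈) 0<y+s
      1≤∣x∣ : 1# ≤ ∣ x ∣
      1≤∣x∣ = begin
        1#      ≤⟨ 1≤[1+s]^n 0<s n ⟩
        y       ≤⟨ x≤x+y y (inj₁ 0<s) ⟩
        y + s   ≈⟨ ∣x∣≈ ⟨
        ∣ x ∣   ∎
      same : sign n * x ≈ ∣ x ∣
      same = trans (sign-*-involutive n _) (sym ∣x∣≈)
      det = detection x 1≤∣x∣
      t : Carrier
      t = proj₁ det
      isDetection : IsDetectionTime σ x t
      isDetection = proj₁ (proj₂ det)
      i : ℕ
      i = proj₁ (proj₂ (proj₂ det))
      pass : Pass x t i
      pass = proj₂ (proj₂ (proj₂ det))
      late : suc (suc n) ℕ.≤′ i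
      late = ℕₚ.≤⇒≤′ (covers⇒late n same (<-respʳ-≈ (sym ∣x∣≈) (x<x+y y 0<s)) (pass⇒covers pass))
      0<C-b : 0# < C - b
      0<C-b = x<y⇒0<y-x b<C
      -- The choice of n makes `y * (C - b)` exceed `b * s + slack`. With `slack` added on both
      -- sides, `turning-time` applies directly to round n + 2, whose sweep begins at `y`.
      below : b * ∣ x ∣ + slack < T (suc (suc n)) + y + slack
      below = begin-strict
        b * ∣ x ∣ + slack                ≈⟨ +-congʳ (*-congˡ ∣x∣≈) ⟩
        b * (y + s) + slack
          ≈⟨ solve 4 (λ b y s D → b :* (y :+ s) :+ D := b :* y :+ (b :* s :+ D)) refl b y s slack ⟩
        b * y + (b * s + slack)          ≈⟨ +-congˡ (x/y*y≈x _ 0<C-b) ⟨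
        b * y + (b * s + slack) / (C - b) * (C - b)
                                         <⟨ +-monoʳ-< _ (*-monoˡ-< 0<C-b large) ⟩
        b * y + y * (C - b)              ≈⟨ +-congˡ (*-comm _ _) ⟩
        b * y + (C - b) * y              ≈⟨ distribʳ y b (C - b) ⟨
        (b + (C - b)) * y                ≈⟨ *-congʳ (x+[y-x]≈y b C) ⟩
        C * y                            ≈⟨ turning-time (suc (suc n)) ⟨
        T (suc (suc n)) + y + slack      ∎

    competitive-ratio : IsCompetitiveRatio σ C
    competitive-ratio =
      (λ x 1≤∣x∣ → proj₁ (detection x 1≤∣x∣) , proj₁ (proj₂ (detection x 1≤∣x∣))) ,
      record { upperBound = upperBound ; approached = approached }

-- The closed form of the ratio for the given expansion factor.

theorem2 : (ℝ : CompleteOrderedField) →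
    let open CompleteOrderedField ℝ
        open RealFunctions ℝ
        open Search ℝ
    in (v : Carrier) → 0# < v → v < 1# →
       let a = 1# + √ ((2# * v ^ 2) / (v * (1# + v)))
       in IsCompetitiveRatio v (zigzag v a) (3# + 2# * √ (2# + 2# / v) + 2# / v)
theorem2 ℝ v 0<v _ = competitive-ratio
  where
  open CompleteOrderedField ℝ
  open RealFunctions ℝ
  open OrderedFieldProperties orderedField

  w X s q C : Carrier
  w = v ⁻¹
  X = v * (1# + v)
  s = √ ((2# * v ^ 2) / X)
  q = √ (2# + 2# / v)
  C = 3# + 2# * q + 2# / v

  vw≈1 : v * w ≈ 1#
  vw≈1 = ⁻¹-inverseʳ (pos⇒≉0 0<v)

  0<w : 0# < w
  0<w = ⁻¹-pos 0<v

  0<2 : 0# < 2#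
  0<2 = +-pos 0<1 0<1

  0<X : 0# < X
  0<X = *-pos 0<v (+-pos 0<1 0<v)

  s-isSqrt : IsSqrt s ((2# * v ^ 2) / X)
  s-isSqrt = √-isSqrt (inj₁ (*-pos (*-pos 0<2 (*-pos 0<v (*-pos 0<v 0<1))) (⁻¹-pos 0<X)))

  q-isSqrt : IsSqrt q (2# + 2# * w)
  q-isSqrt = √-isSqrt (inj₁ (+-pos 0<2 (*-pos 0<2 0<w)))

  -- The radicand is 2 / (1 + w). The solver knows no inverses, so 1 is replaced by `v * w` until
  -- the factor `X` can be split off and cancelled.
  s²[1+w]≈2 : s * s * (1# + w) ≈ 2#
  s²[1+w]≈2 = begin-equality
    s * s * (1# + w)                     ≈⟨ *-congˡ (+-congʳ vw≈1) ⟨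
    s * s * (v * w + w)                  ≈⟨ *-identityˡ _ ⟨
    1# * (s * s * (v * w + w))           ≈⟨ *-congʳ vw≈1 ⟨
    v * w * (s * s * (v * w + w))
      ≈⟨ solve 3 (λ s v w → v :* w :* (s :* s :* (v :* w :+ w)) := s :* s :* (v :* (con 1 :+ v)) :* (w :* w))
               refl s v w ⟩
    s * s * X * (w * w)                  ≈⟨ *-congʳ (trans (*-congʳ (proj₂ s-isSqrt)) (x/y*y≈x _ 0<X)) ⟩
    2# * v ^ 2 * (w * w)
      ≈⟨ solve 2 (λ v w → con 2 :* (v :* (v :* con 1)) :* (w :* w) := con 2 :* ((v :* w) :* (v :* w)))
               refl v w ⟩
    2# * ((v * w) * (v * w))             ≈⟨ *-congˡ (trans (*-cong vw≈1 vw≈1) (*-identityˡ 1#)) ⟩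
    2# * 1#                              ≈⟨ *-identityʳ 2# ⟩
    2#                                   ∎

  0<s : 0# < s
  0<s with proj₁ s-isSqrt
  ... | inj₁ p = p
  ... | inj₂ p = ⊥-elim (irrefl (begin-equality
    0#                 ≈⟨ zeroˡ _ ⟨
    0# * (s * (1# + w))  ≈⟨ *-congʳ p ⟩
    s * (s * (1# + w))  ≈⟨ *-assoc _ _ _ ⟨
    s * s * (1# + w)   ≈⟨ s²[1+w]≈2 ⟩
    2#                 ∎) 0<2)

  -- Both sides are nonnegative and have square 4. This eliminates the second square root from
  -- `s * C`.
  qs≈2 : q * s ≈ 2#
  qs≈2 = square-injective (*-nonneg (proj₁ q-isSqrt) (inj₁ 0<s)) 0<2 (begin-equality
    q * s * (q * s)          ≈⟨ solve 2 (λ q s → q :* s :* (q :* s) := q :* q :* (s :* s)) refl q s ⟩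
    q * q * (s * s)          ≈⟨ *-congʳ (proj₂ q-isSqrt) ⟩
    (2# + 2# * w) * (s * s)
      ≈⟨ solve 2 (λ s w → (con 2 :+ con 2 :* w) :* (s :* s) := con 2 :* (s :* s :* (con 1 :+ w)))
               refl s w ⟩
    2# * (s * s * (1# + w))  ≈⟨ *-congˡ s²[1+w]≈2 ⟩
    2# * 2#                  ∎)

  open Zigzag ℝ v s 0<v 0<s using (a; g; module CompetitiveRatio)

  s*C≈ : s * C ≈ a * a + a + g * w
  s*C≈ = begin-equality
    s * C
      ≈⟨ solve 3 (λ s q w → s :* (con 3 :+ con 2 :* q :+ con 2 :* w)
                         := con 2 :* (q :* s) :+ (con 3 :* s :+ con 2 :* s :* w)) refl s q w ⟩
    2# * (q * s) + (3# * s + 2# * s * w)         ≈⟨ +-congʳ (*-congˡ qs≈2) ⟩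
    2# * 2# + (3# * s + 2# * s * w)
      ≈⟨ solve 2 (λ s w → con 2 :* con 2 :+ (con 3 :* s :+ con 2 :* s :* w)
                       := con 2 :+ (con 2 :+ (con 3 :* s :+ con 2 :* s :* w))) refl s w ⟩
    -- Only one of the two summands 2 is traded for `s * s * (1# + w)`; the other is the constant
    -- term of `a * a + a`.
    2# + (2# + (3# * s + 2# * s * w))            ≈⟨ +-congʳ s²[1+w]≈2 ⟨
    s * s * (1# + w) + (2# + (3# * s + 2# * s * w))
      ≈⟨ solve 2 (λ s w → let a = con 1 :+ s ; g = s :+ s :+ s :* s in
                   s :* s :* (con 1 :+ w) :+ (con 2 :+ (con 3 :* s :+ con 2 :* s :* w))
                := a :* a :+ a :+ g :* w) refl s w ⟩
    a * a + a + g * w                            ∎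

  0≤2+2q : 0# ≤ 2# + 2# * q
  0≤2+2q = ≤-trans (inj₁ 0<2) (x≤x+y _ (*-nonneg (inj₁ 0<2) (proj₁ q-isSqrt)))

  w≤C : w ≤ C
  w≤C = begin
    w                                 ≤⟨ x≤x+y w (≤-trans 0≤2+2q (x≤x+y _ (inj₁ (+-pos 0<1 0<w)))) ⟩
    w + (2# + 2# * q + (1# + w))
      ≈⟨ solve 2 (λ q w → w :+ (con 2 :+ con 2 :* q :+ (con 1 :+ w)) := con 3 :+ con 2 :* q :+ con 2 :* w)
               refl q w ⟩
    C                                 ∎

  1≤C : 1# ≤ C
  1≤C = begin
    1#                                ≤⟨ x≤x+y 1# (≤-trans 0≤2+2q (x≤x+y _ (inj₁ (*-pos 0<2 0<w)))) ⟩
    1# + (2# + 2# * q + 2# * w)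
      ≈⟨ solve 2 (λ q w → con 1 :+ (con 2 :+ con 2 :* q :+ con 2 :* w) := con 3 :+ con 2 :* q :+ con 2 :* w)
               refl q w ⟩
    C                                 ∎

  open CompetitiveRatio C w≤C 1≤C s*C≈
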